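{- Let $C$ be the set of rational Cauchy sequences, with the closeness relation $\sim$, the elements $0_C,1_C$, the operations $+,\cdot$ and the relation $<$ defined in the context. Then the structure $(C,\,0_C,\,1_C,\,+,\,\cdot,\,<)$ is an ordered field congruent to the closeness relation $\sim$ (in the sense defined in the context).
   Context: Here $\mathbb{N}=\{1,2,3,\dots\}$, and $k,l,m,n,n_0,\dots$ range over $\mathbb{N}$. A sequence $(a_n)=(a_n)_{n\in\mathbb{N}}$ in $\mathbb{Q}$ is Cauchy if $\forall k\,\exists n_0\,(m,n\ge n_0\Rightarrow |a_m-a_n|\le 1/k)$. Let $C$ be the set of all Cauchy sequences in $\mathbb{Q}$ (two elements of $C$ are equal only if they are equal as sequences; no quotient is taken). The closeness relation $\sim$ on $C$ is the equivalence relation $(a_n)\sim(b_n)\iff \forall k\,\exists n_0\,(n\ge n_0\Rightarrow |a_n-b_n|\le 1/k)$. Put $0_C:=(0,0,\dots)$, $1_C:=(1,1,\dots)$, $(a_n)+(b_n):=(a_n+b_n)$, $(a_n)\cdot(b_n):=(a_nb_n)$, and $(a_n)<(b_n)\iff \exists k\,\exists n_0\,(n\ge n_0\Rightarrow a_n<b_n-1/k)$. Let $X$ be a nonempty set with an equivalence relation $\sim$. A binary operation $+$ on $X$ is congruent to $\sim$ if $a\sim a'$ and $b\sim b'$ imply $a+b\sim a'+b'$ for all $a,a',b,b'\in X$. A binary relation $A$ on $X$ is congruent to $\sim$ if $a\sim a'$ and $b\sim b'$ imply ($aAb\iff a'Ab'$) for all $a,a',b,b'\in X$. An ordered field (on $X$)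 congruent to $\sim$ is a six-tuple $(X,0_X,1_X,+,\cdot,<)$ such that: (1) $(X,0_X,1_X,+,\cdot)$ is a commutative ring with identity (ring axioms hold with genuine equality $=$); (2) the operations $+$ and $\cdot$ are congruent to $\sim$; (3) $<$ is an irreflexive and transitive relation on $X$ that is congruent to $\sim$; (4) for all $a,b,c\in X$: $a<b\Rightarrow a+c<b+c$, and ($a>0_X$ and $b>0_X$) $\Rightarrow a\cdot b>0_X$; (5) (weak multiplicative inverses) for every $a\in X$ with $a\not\sim 0_X$ there is $b\in X$ with $a\cdot b\sim 1_X$; (6) (weak trichotomy) for all $a,b\in X$: $a<b$ or $b<a$ or $a\sim b$. -}

module Defs where

open import Algebra.Core using (Op₁; Op₂)
open import Algebra.Definitions using (Congruent₂)
open import Algebra.Structures using (IsCommutativeRing)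
open import Data.Integer.Base as ℤ using (+_; +≤+)
import Data.Integer.Properties as ℤ
open import Data.Nat.Base as ℕ using (ℕ; suc)
import Data.Nat.Properties as ℕ
open import Data.Nat.Solver using (module +-*-Solver)
open import Data.Product.Base using (∃-syntax; _,_)
open import Data.Rational.Base as ℚ using (ℚ; 0ℚ; 1ℚ; ∣_∣; toℚᵘ)
import Data.Rational.Properties as ℚ
import Data.Rational.Solver as ℚ
open import Data.Rational.Unnormalised.Base as ℚᵘ using (mkℚᵘ; *≡*; *≤*)
import Data.Rational.Unnormalised.Properties as ℚᵘ
open import Data.Sum.Base using (_⊎_)
open import Function.Bundles using (_⇔_)
open import Level using (Level; 0ℓ; _⊔_)
open import Relation.Binary.Core using (Rel; _⇒_)
open import Relation.Binary.Definitions using (Irreflexive; Transitive)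
open import Relation.Binary.PropositionalEquality.Core using (_≡_; refl; sym; trans; cong; cong₂; subst)
open import Relation.Binary.Structures using (IsEquivalence)
open import Relation.Nullary.Negation.Core using (¬_)

private
  variable
    x e l r : Level

CongruentRel : {X : Set x} → Rel X e → Rel X l → Set (x ⊔ e ⊔ l)
CongruentRel _∼_ A = ∀ {a a′ b b′} → a ∼ a′ → b ∼ b′ → A a b ⇔ A a′ b′

-- _≈_ plays the role of genuine equality on the set X (sets are setoids here),
-- while _∼_ is the coarser relation to which the structure is congruent.  That
-- _∼_ is an equivalence relation on the set X, presupposed by the notion, is
-- recorded by ∼-isEquivalence and ≈⇒∼.
record IsOrderedFieldCongruentTo
  {X : Set x} (_≈_ : Rel X e) (_∼_ : Rel X r)
  (0# 1# : X) (_+_ _*_ : Op₂ X) (_<_ : Rel X l) : Set (x ⊔ e ⊔ r ⊔ l) where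
  field
    ∼-isEquivalence   : IsEquivalence _∼_
    ≈⇒∼               : _≈_ ⇒ _∼_

    -_                : Op₁ X
    isCommutativeRing : IsCommutativeRing _≈_ _+_ _*_ -_ 0# 1#

    +-congruent       : Congruent₂ _∼_ _+_
    *-congruent       : Congruent₂ _∼_ _*_

    <-irrefl          : Irreflexive _≈_ _<_
    <-trans           : Transitive _<_
    <-congruent       : CongruentRel _∼_ _<_

    +-mono-<          : ∀ a b c → a < b → (a + c) < (b + c)
    *-pos             : ∀ a b → 0# < a → 0# < b → 0# < (a * b)

    weakInverse       : ∀ a → ¬ (a ∼ 0#) → ∃[ b ] ((a * b) ∼ 1#)
    weakTrichotomy    : ∀ a b → a < b ⊎ b < a ⊎ a ∼ b

record ℕ⁺ : Set where
  constructor mkℕ⁺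
  field
    value         : ℕ
    .{{nonZero}}  : ℕ.NonZero value

open ℕ⁺ using (value)

infix 4 _≤⁺_

_≤⁺_ : Rel ℕ⁺ 0ℓ
m ≤⁺ n = value m ℕ.≤ value n

1/⁺_ : ℕ⁺ → ℚ
1/⁺ (mkℕ⁺ k) = + 1 ℚ./ k

IsCauchy : (ℕ⁺ → ℚ) → Set
IsCauchy a = ∀ k → ∃[ n₀ ] (∀ m n → n₀ ≤⁺ m → n₀ ≤⁺ n → ∣ a m ℚ.- a n ∣ ℚ.≤ 1/⁺ k)

record C : Set where
  constructor mkC
  field
    seq      : ℕ⁺ → ℚ
    isCauchy : IsCauchy seq

open C using (seq; isCauchy)

infix 4 _≈_ _∼_ _<_

-- Equality of elements of C: equality as sequences, ignoring the proofs of
-- the Cauchy property.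
_≈_ : Rel C 0ℓ
a ≈ b = ∀ n → seq a n ≡ seq b n

_∼_ : Rel C 0ℓ
a ∼ b = ∀ k → ∃[ n₀ ] (∀ n → n₀ ≤⁺ n → ∣ seq a n ℚ.- seq b n ∣ ℚ.≤ 1/⁺ k)

_<_ : Rel C 0ℓ
a < b = ∃[ k ] ∃[ n₀ ] (∀ n → n₀ ≤⁺ n → seq a n ℚ.< seq b n ℚ.- 1/⁺ k)

-- The lemmas up to *-isCauchy serve only to show that C is closed under the
-- pointwise operations.

infixl 7 _*⁺_
infixl 6 _⊔⁺_

_*⁺_ : Op₂ ℕ⁺
mkℕ⁺ m *⁺ mkℕ⁺ n = mkℕ⁺ (m ℕ.* n) {{ℕ.m*n≢0 m n}}

_⊔⁺_ : Op₂ ℕ⁺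
mkℕ⁺ (suc m) ⊔⁺ mkℕ⁺ (suc n) = mkℕ⁺ (suc m ℕ.⊔ suc n)

m⊔⁺n≤o⇒m≤o : ∀ m n {o} → value (m ⊔⁺ n) ℕ.≤ o → value m ℕ.≤ o
m⊔⁺n≤o⇒m≤o (mkℕ⁺ (suc m)) (mkℕ⁺ (suc n)) = ℕ.m⊔n≤o⇒m≤o (suc m) (suc n)

m⊔⁺n≤o⇒n≤o : ∀ m n {o} → value (m ⊔⁺ n) ℕ.≤ o → value n ℕ.≤ o
m⊔⁺n≤o⇒n≤o (mkℕ⁺ (suc m)) (mkℕ⁺ (suc n)) = ℕ.m⊔n≤o⇒n≤o (suc m) (suc n)

1⁺ 2⁺ : ℕ⁺
1⁺ = mkℕ⁺ 1
2⁺ = mkℕ⁺ 2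

toℚ : ℕ⁺ → ℚ
toℚ k = + value k ℚ./ 1

toℚ*1/⁺ : ∀ j k → toℚ j ℚ.* 1/⁺ (j *⁺ k) ≡ 1/⁺ k
toℚ*1/⁺ (mkℕ⁺ j@(suc j′)) (mkℕ⁺ k@(suc k′)) = ℚ.toℚᵘ-injective (begin
  toℚᵘ (+ j ℚ./ 1 ℚ.* (+ 1 ℚ./ jk))               ≈⟨ ℚ.toℚᵘ-homo-* (+ j ℚ./ 1) (+ 1 ℚ./ jk) ⟩
  toℚᵘ (+ j ℚ./ 1) ℚᵘ.* toℚᵘ (+ 1 ℚ./ jk)         ≈⟨ ℚᵘ.*-cong (ℚ.toℚᵘ-fromℚᵘ (mkℚᵘ (+ j) 0)) (ℚ.toℚᵘ-fromℚᵘ (mkℚᵘ (+ 1) _)) ⟩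
  mkℚᵘ (+ j) 0 ℚᵘ.* mkℚᵘ (+ 1) (k′ ℕ.+ j′ ℕ.* k)  ≈⟨ *≡* (cong +_ (solve 2 (λ j k → (j :* con 1) :* k := con 1 :* (con 1 :* (j :* k))) refl j k)) ⟩
  mkℚᵘ (+ 1) k′                                   ≈⟨ ℚ.toℚᵘ-fromℚᵘ (mkℚᵘ (+ 1) k′) ⟨
  toℚᵘ (+ 1 ℚ./ k)                                ∎)
  where
  open ℚᵘ.≃-Reasoning
  open +-*-Solver
  jk = j ℕ.* k

1/⁺-halves : ∀ k → 1/⁺ (2⁺ *⁺ k) ℚ.+ 1/⁺ (2⁺ *⁺ k) ≡ 1/⁺ k
1/⁺-halves k = trans (solve 1 (λ h → h :+ h := con (toℚ 2⁺) :* h) refl (1/⁺ (2⁺ *⁺ k))) (toℚ*1/⁺ 2⁺ k)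
  where open ℚ.+-*-Solver

archimedean : ∀ q → ∃[ j ] (q ℚ.≤ toℚ j)
archimedean q@(ℚ.mkℚ p d-1 _) = mkℕ⁺ j , ℚ.toℚᵘ-cancel-≤ (begin
  mkℚᵘ p d-1       ≤⟨ *≤* p*1≤j*d ⟩
  mkℚᵘ (+ j) 0     ≃⟨ ℚ.toℚᵘ-fromℚᵘ (mkℚᵘ (+ j) 0) ⟨
  toℚᵘ (+ j ℚ./ 1) ∎)
  where
  open ℚᵘ.≤-Reasoning
  j = suc ℤ.∣ p ∣
  i≤∣i∣ : ∀ i → i ℤ.≤ + ℤ.∣ i ∣
  i≤∣i∣ (+ n)        = ℤ.≤-refl
  i≤∣i∣ (ℤ.-[1+ n ]) = ℤ.-≤+
  p*1≤j*d : p ℤ.* + 1 ℤ.≤ + j ℤ.* + suc d-1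
  p*1≤j*d = subst (ℤ._≤ + j ℤ.* + suc d-1) (sym (ℤ.*-identityʳ p))
    (ℤ.≤-trans (i≤∣i∣ p) (+≤+ (ℕ.≤-trans (ℕ.n≤1+n _) (ℕ.m≤m*n j (suc d-1)))))

toℚ-nonNeg : ∀ j → ℚ.NonNegative (toℚ j)
toℚ-nonNeg (mkℕ⁺ j) = ℚ.normalize-nonNeg j 1

∣p*q∣≤ : ∀ {p q c} j → ∣ p ∣ ℚ.≤ toℚ j → ∣ q ∣ ℚ.≤ c → ∣ p ℚ.* q ∣ ℚ.≤ toℚ j ℚ.* c
∣p*q∣≤ {p} {q} {c} j p≤j q≤c = begin
  ∣ p ℚ.* q ∣       ≡⟨ ℚ.∣p*q∣≡∣p∣*∣q∣ p q ⟩
  ∣ p ∣ ℚ.* ∣ q ∣   ≤⟨ ℚ.*-monoʳ-≤-nonNeg ∣ q ∣ {{ℚ.∣-∣-nonNeg q}} p≤j ⟩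
  toℚ j ℚ.* ∣ q ∣   ≤⟨ ℚ.*-monoˡ-≤-nonNeg (toℚ j) {{toℚ-nonNeg j}} q≤c ⟩
  toℚ j ℚ.* c       ∎
  where open ℚ.≤-Reasoning

eventuallyBounded : ∀ {a} → IsCauchy a → ∃[ j ] ∃[ n₀ ] (∀ n → n₀ ≤⁺ n → ∣ a n ∣ ℚ.≤ toℚ j)
eventuallyBounded {a} ca =
  let n₀ , close   = ca 1⁺
      j  , bounded = archimedean (1/⁺ 1⁺ ℚ.+ ∣ a n₀ ∣)
      open ℚ.≤-Reasoning
      open ℚ.+-*-Solver
  in j , n₀ , λ n n₀≤n → begin
    ∣ a n ∣                        ≡⟨ cong ∣_∣ (solve 2 (λ p q → p := (p :- q) :+ q) refl (a n) (a n₀)) ⟩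
    ∣ (a n ℚ.- a n₀) ℚ.+ a n₀ ∣    ≤⟨ ℚ.∣p+q∣≤∣p∣+∣q∣ (a n ℚ.- a n₀) (a n₀) ⟩
    ∣ a n ℚ.- a n₀ ∣ ℚ.+ ∣ a n₀ ∣  ≤⟨ ℚ.+-monoˡ-≤ ∣ a n₀ ∣ (close n n₀ n₀≤n ℕ.≤-refl) ⟩
    1/⁺ 1⁺ ℚ.+ ∣ a n₀ ∣            ≤⟨ bounded ⟩
    toℚ j                          ∎

const-isCauchy : ∀ q → IsCauchy (λ _ → q)
const-isCauchy q (mkℕ⁺ k) = 1⁺ , λ _ _ _ _ → begin
  ∣ q ℚ.- q ∣  ≡⟨ cong ∣_∣ (ℚ.+-inverseʳ q) ⟩
  0ℚ           ≤⟨ ℚ.nonNegative⁻¹ (+ 1 ℚ./ k) {{ℚ.normalize-nonNeg 1 k}} ⟩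
  + 1 ℚ./ k    ∎
  where open ℚ.≤-Reasoning

+-isCauchy : ∀ {a b} → IsCauchy a → IsCauchy b → IsCauchy (λ n → a n ℚ.+ b n)
+-isCauchy {a} {b} ca cb k =
  let h = 2⁺ *⁺ k
      n₁ , closeᵃ = ca h
      n₂ , closeᵇ = cb h
      ≥n₁ = λ {o} → m⊔⁺n≤o⇒m≤o n₁ n₂ {o}
      ≥n₂ = λ {o} → m⊔⁺n≤o⇒n≤o n₁ n₂ {o}
      open ℚ.≤-Reasoning
      open ℚ.+-*-Solver
  in n₁ ⊔⁺ n₂ , λ m n m≥ n≥ → begin
    ∣ (a m ℚ.+ b m) ℚ.- (a n ℚ.+ b n) ∣    ≡⟨ cong ∣_∣ (solve 4 (λ p q r s → (p :+ q) :- (r :+ s) := (p :- r) :+ (q :- s)) refl (a m) (b m) (a n) (b n)) ⟩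
    ∣ (a m ℚ.- a n) ℚ.+ (b m ℚ.- b n) ∣    ≤⟨ ℚ.∣p+q∣≤∣p∣+∣q∣ (a m ℚ.- a n) (b m ℚ.- b n) ⟩
    ∣ a m ℚ.- a n ∣ ℚ.+ ∣ b m ℚ.- b n ∣    ≤⟨ ℚ.+-mono-≤ (closeᵃ m n (≥n₁ m≥) (≥n₁ n≥)) (closeᵇ m n (≥n₂ m≥) (≥n₂ n≥)) ⟩
    1/⁺ h ℚ.+ 1/⁺ h                        ≡⟨ 1/⁺-halves k ⟩
    1/⁺ k                                  ∎

*-isCauchy : ∀ {a b} → IsCauchy a → IsCauchy b → IsCauchy (λ n → a n ℚ.* b n)
*-isCauchy {a} {b} ca cb k =
  let h = 2⁺ *⁺ k
      i , n₁ , boundᵃ = eventuallyBounded {a} ca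
      j , n₂ , boundᵇ = eventuallyBounded {b} cb
      n₃ , closeᵃ = ca (j *⁺ h)
      n₄ , closeᵇ = cb (i *⁺ h)
      n₁₂ = n₁ ⊔⁺ n₂
      n₃₄ = n₃ ⊔⁺ n₄
      ≥n₁ = λ {o} n≥ → m⊔⁺n≤o⇒m≤o n₁ n₂ {o} (m⊔⁺n≤o⇒m≤o n₁₂ n₃₄ n≥)
      ≥n₂ = λ {o} n≥ → m⊔⁺n≤o⇒n≤o n₁ n₂ {o} (m⊔⁺n≤o⇒m≤o n₁₂ n₃₄ n≥)
      ≥n₃ = λ {o} n≥ → m⊔⁺n≤o⇒m≤o n₃ n₄ {o} (m⊔⁺n≤o⇒n≤o n₁₂ n₃₄ n≥)
      ≥n₄ = λ {o} n≥ → m⊔⁺n≤o⇒n≤o n₃ n₄ {o} (m⊔⁺n≤o⇒n≤o n₁₂ n₃₄ n≥)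
      open ℚ.≤-Reasoning
      open ℚ.+-*-Solver
  in n₁₂ ⊔⁺ n₃₄ , λ m n m≥ n≥ → begin
    ∣ a m ℚ.* b m ℚ.- a n ℚ.* b n ∣
      ≡⟨ cong ∣_∣ (solve 4 (λ p q r s → p :* q :- r :* s := p :* (q :- s) :+ s :* (p :- r)) refl (a m) (b m) (a n) (b n)) ⟩
    ∣ a m ℚ.* (b m ℚ.- b n) ℚ.+ b n ℚ.* (a m ℚ.- a n) ∣
      ≤⟨ ℚ.∣p+q∣≤∣p∣+∣q∣ (a m ℚ.* (b m ℚ.- b n)) (b n ℚ.* (a m ℚ.- a n)) ⟩
    ∣ a m ℚ.* (b m ℚ.- b n) ∣ ℚ.+ ∣ b n ℚ.* (a m ℚ.- a n) ∣
      ≤⟨ ℚ.+-mono-≤ (∣p*q∣≤ {a m} i (boundᵃ m (≥n₁ m≥)) (closeᵇ m n (≥n₄ m≥) (≥n₄ n≥)))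
                    (∣p*q∣≤ {b n} j (boundᵇ n (≥n₂ n≥)) (closeᵃ m n (≥n₃ m≥) (≥n₃ n≥))) ⟩
    toℚ i ℚ.* 1/⁺ (i *⁺ h) ℚ.+ toℚ j ℚ.* 1/⁺ (j *⁺ h)
      ≡⟨ cong₂ ℚ._+_ (toℚ*1/⁺ i h) (toℚ*1/⁺ j h) ⟩
    1/⁺ h ℚ.+ 1/⁺ h
      ≡⟨ 1/⁺-halves k ⟩
    1/⁺ k ∎

0C 1C : C
0C = mkC (λ _ → 0ℚ) (const-isCauchy 0ℚ)
1C = mkC (λ _ → 1ℚ) (const-isCauchy 1ℚ)

infixl 7 _*_
infixl 6 _+_

_+_ : Op₂ C
a + b = mkC (λ n → seq a n ℚ.+ seq b n) (+-isCauchy {seq a} {seq b} (isCauchy a) (isCauchy b))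

_*_ : Op₂ C
a * b = mkC (λ n → seq a n ℚ.* seq b n) (*-isCauchy {seq a} {seq b} (isCauchy a) (isCauchy b))

{-# OPTIONS --safe #-}

-- The ring laws hold pointwise, and congruence of + and * reduces to null
-- sequences being closed under sums and under products with Cauchy (hence
-- eventually bounded) sequences.  For trichotomy, a Cauchy sequence c and any k
-- satisfy one of: c is eventually above a positive constant, or c is eventually
-- at most 1/k; applied to b − a and a − b this turns the failure of a < b and
-- b < a into closeness.  By trichotomy, a sequence not close to 0 is eventually
-- bounded away from 0, so its termwise reciprocal (with an arbitrary value at
-- the finitely many possible zeros) is again Cauchy.
module Submission where

open import Algebra.Core using (Op₁)
open import Algebra.Structures using (IsCommutativeRing)
open import Axiom.ExcludedMiddle using (ExcludedMiddle)
open import Data.Empty using (⊥-elim)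
import Data.Nat.Properties as ℕ
open import Data.Product.Base using (∃-syntax; _,_)
open import Data.Rational.Base as ℚ using (ℚ; 0ℚ; 1ℚ; ∣_∣)
import Data.Rational.Properties as ℚ
import Data.Rational.Solver as ℚ
open import Data.Sum.Base as Sum using (_⊎_; inj₁; inj₂; [_,_]′)
open import Function.Base using (id)
open import Function.Bundles using (mk⇔)
open import Level using (0ℓ)
open import Relation.Binary.Definitions using (Irreflexive; Transitive)
open import Relation.Binary.PropositionalEquality using (_≡_; _≢_; refl; sym; trans; cong; cong₂; subst; module ≡-Reasoning)
open import Relation.Binary.Structures using (IsEquivalence)
open import Relation.Nullary using (¬_; yes; no)
open import Defs
open ℕ⁺ using (value)
open C using (seq; isCauchy)

-- Rational numbers

p≤∣p∣ : ∀ p → p ℚ.≤ ∣ p ∣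
p≤∣p∣ p with ℚ.≤-total 0ℚ p
... | inj₁ 0≤p = ℚ.≤-reflexive (sym (ℚ.0≤p⇒∣p∣≡p 0≤p))
... | inj₂ p≤0 = ℚ.≤-trans p≤0 (ℚ.0≤∣p∣ p)

p≤q∧-p≤q⇒∣p∣≤q : ∀ {p q} → p ℚ.≤ q → ℚ.- p ℚ.≤ q → ∣ p ∣ ℚ.≤ q
p≤q∧-p≤q⇒∣p∣≤q {p} {q} p≤q -p≤q with ℚ.∣p∣≡p∨∣p∣≡-p p
... | inj₁ ∣p∣≡p  = subst (ℚ._≤ q) (sym ∣p∣≡p) p≤q
... | inj₂ ∣p∣≡-p = subst (ℚ._≤ q) (sym ∣p∣≡-p) -p≤q

-[p-q]≡q-p : ∀ p q → ℚ.- (p ℚ.- q) ≡ q ℚ.- p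
-[p-q]≡q-p = solve 2 (λ p q → :- (p :- q) := q :- p) refl
  where open ℚ.+-*-Solver

∣p-q∣≡∣q-p∣ : ∀ p q → ∣ p ℚ.- q ∣ ≡ ∣ q ℚ.- p ∣
∣p-q∣≡∣q-p∣ p q = trans (sym (ℚ.∣-p∣≡∣p∣ (p ℚ.- q))) (cong ∣_∣ (-[p-q]≡q-p p q))

∣p-q∣≤r⇒p≤q+r : ∀ p q {r} → ∣ p ℚ.- q ∣ ℚ.≤ r → p ℚ.≤ q ℚ.+ r
∣p-q∣≤r⇒p≤q+r p q {r} ∣p-q∣≤r = begin
  p                    ≡⟨ solve 2 (λ p q → p := q :+ (p :- q)) refl p q ⟩
  q ℚ.+ (p ℚ.- q)      ≤⟨ ℚ.+-monoʳ-≤ q (p≤∣p∣ (p ℚ.- q)) ⟩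
  q ℚ.+ ∣ p ℚ.- q ∣    ≤⟨ ℚ.+-monoʳ-≤ q ∣p-q∣≤r ⟩
  q ℚ.+ r              ∎
  where
  open ℚ.≤-Reasoning
  open ℚ.+-*-Solver

-- Interchanges the smaller term and the gap: `a n < b n - 1/k` becomes the lower bound 1/k on the
-- difference, and conversely.
p<q-r⇒r<q-p : ∀ p q r → p ℚ.< q ℚ.- r → r ℚ.< q ℚ.- p
p<q-r⇒r<q-p p q r p<q-r = begin-strict
  r                            ≡⟨ solve 2 (λ p r → r := p :+ (r :- p)) refl p r ⟩
  p ℚ.+ (r ℚ.- p)              <⟨ ℚ.+-monoˡ-< (r ℚ.- p) p<q-r ⟩
  (q ℚ.- r) ℚ.+ (r ℚ.- p)      ≡⟨ solve 3 (λ p q r → (q :- r) :+ (r :- p) := q :- p) refl p q r ⟩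
  q ℚ.- p                      ∎
  where
  open ℚ.≤-Reasoning
  open ℚ.+-*-Solver

p+r<q+r⇒p<q : ∀ p q r → p ℚ.+ r ℚ.< q ℚ.+ r → p ℚ.< q
p+r<q+r⇒p<q p q r p+r<q+r = begin-strict
  p                  ≡⟨ solve 2 (λ p r → p := p :+ r :- r) refl p r ⟩
  p ℚ.+ r ℚ.- r      <⟨ ℚ.+-monoˡ-< (ℚ.- r) p+r<q+r ⟩
  q ℚ.+ r ℚ.- r      ≡⟨ solve 2 (λ q r → q :+ r :- r := q) refl q r ⟩
  q                  ∎
  where
  open ℚ.≤-Reasoning
  open ℚ.+-*-Solver

1/⁺-pos : ∀ k → ℚ.Positive (1/⁺ k)
1/⁺-pos (mkℕ⁺ k) = ℚ.normalize-pos 1 k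

0<1/⁺ : ∀ k → 0ℚ ℚ.< 1/⁺ k
0<1/⁺ k = ℚ.positive⁻¹ (1/⁺ k) {{1/⁺-pos k}}

p-1/⁺k<p : ∀ p k → p ℚ.- 1/⁺ k ℚ.< p
p-1/⁺k<p p k = subst (p ℚ.- 1/⁺ k ℚ.<_) (ℚ.+-identityʳ p)
  (ℚ.+-monoʳ-< p (ℚ.neg-antimono-< (0<1/⁺ k)))

-- The nonzero proof stored in `ℕ⁺` is irrelevant, so equal values already give definitionally equal
-- fractions.
1/⁺-cong : ∀ {j k} → value j ≡ value k → 1/⁺ j ≡ 1/⁺ k
1/⁺-cong {mkℕ⁺ _} {mkℕ⁺ _} refl = refl

toℚ-inverseʳ : ∀ k → toℚ k ℚ.* 1/⁺ k ≡ 1ℚ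
toℚ-inverseʳ k = trans (cong (toℚ k ℚ.*_) (1/⁺-cong {k} {k *⁺ 1⁺} (sym (ℕ.*-identityʳ (value k))))) (toℚ*1/⁺ k 1⁺)

-- After inserting 1 = j · (1/j) on the left, the factor j cancels against 1/(jk) by `toℚ*1/⁺`.
1/⁺-*⁺ : ∀ j k → 1/⁺ (j *⁺ k) ≡ 1/⁺ j ℚ.* 1/⁺ k
1/⁺-*⁺ j k = begin
  1/⁺ (j *⁺ k)                          ≡⟨ ℚ.*-identityˡ (1/⁺ (j *⁺ k)) ⟨
  1ℚ ℚ.* 1/⁺ (j *⁺ k)                   ≡⟨ cong (ℚ._* 1/⁺ (j *⁺ k)) (toℚ-inverseʳ j) ⟨
  toℚ j ℚ.* 1/⁺ j ℚ.* 1/⁺ (j *⁺ k)      ≡⟨ solve 3 (λ p q r → p :* q :* r := q :* (p :* r)) refl (toℚ j) (1/⁺ j) (1/⁺ (j *⁺ k)) ⟩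
  1/⁺ j ℚ.* (toℚ j ℚ.* 1/⁺ (j *⁺ k))    ≡⟨ cong (1/⁺ j ℚ.*_) (toℚ*1/⁺ j k) ⟩
  1/⁺ j ℚ.* 1/⁺ k                       ∎
  where
  open ≡-Reasoning
  open ℚ.+-*-Solver

1/⁺[2*]≤1/⁺ : ∀ k → 1/⁺ (2⁺ *⁺ k) ℚ.≤ 1/⁺ k
1/⁺[2*]≤1/⁺ k = begin
  h          ≡⟨ ℚ.+-identityʳ h ⟨
  h ℚ.+ 0ℚ   ≤⟨ ℚ.+-monoʳ-≤ h (ℚ.<⇒≤ (0<1/⁺ (2⁺ *⁺ k))) ⟩
  h ℚ.+ h    ≡⟨ 1/⁺-halves k ⟩
  1/⁺ k      ∎
  where
  open ℚ.≤-Reasoning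
  h = 1/⁺ (2⁺ *⁺ k)

-- Total, with default value 0 at 0, so that it applies to every term of a sequence without a proof
-- that the term is nonzero.
recip : ℚ → ℚ
recip p with p ℚ.≟ 0ℚ
... | yes _  = 0ℚ
... | no p≢0 = ℚ.1/_ p {{ℚ.≢-nonZero p≢0}}

recip-inverseʳ : ∀ {p} → p ≢ 0ℚ → p ℚ.* recip p ≡ 1ℚ
recip-inverseʳ {p} p≢0 with p ℚ.≟ 0ℚ
... | yes p≡0 = ⊥-elim (p≢0 p≡0)
... | no p≢0  = ℚ.*-inverseʳ p {{ℚ.≢-nonZero p≢0}}

1/⁺k≤∣p∣⇒p≢0 : ∀ {p} k → 1/⁺ k ℚ.≤ ∣ p ∣ → p ≢ 0ℚ
1/⁺k≤∣p∣⇒p≢0 k 1/k≤∣p∣ refl = ℚ.<-irrefl refl (ℚ.<-≤-trans (0<1/⁺ k) 1/k≤∣p∣)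

-- Since |p| · |1/p| = 1, replacing |p| by the smaller 1/k gives (1/k) · |1/p| ≤ 1; multiply by k.
∣recip∣≤ : ∀ {p} k → 1/⁺ k ℚ.≤ ∣ p ∣ → ∣ recip p ∣ ℚ.≤ toℚ k
∣recip∣≤ {p} k 1/k≤∣p∣ = begin
  ∣ r ∣                          ≡⟨ ℚ.*-identityˡ ∣ r ∣ ⟨
  1ℚ ℚ.* ∣ r ∣                   ≡⟨ cong (ℚ._* ∣ r ∣) (toℚ-inverseʳ k) ⟨
  toℚ k ℚ.* 1/⁺ k ℚ.* ∣ r ∣      ≡⟨ ℚ.*-assoc (toℚ k) (1/⁺ k) ∣ r ∣ ⟩
  toℚ k ℚ.* (1/⁺ k ℚ.* ∣ r ∣)    ≤⟨ ℚ.*-monoˡ-≤-nonNeg (toℚ k) {{toℚ-nonNeg k}} (ℚ.*-monoʳ-≤-nonNeg ∣ r ∣ {{ℚ.∣-∣-nonNeg r}} 1/k≤∣p∣) ⟩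
  toℚ k ℚ.* (∣ p ∣ ℚ.* ∣ r ∣)    ≡⟨ cong (toℚ k ℚ.*_) (ℚ.∣p*q∣≡∣p∣*∣q∣ p r) ⟨
  toℚ k ℚ.* ∣ p ℚ.* r ∣          ≡⟨ cong (λ q → toℚ k ℚ.* ∣ q ∣) (recip-inverseʳ (1/⁺k≤∣p∣⇒p≢0 k 1/k≤∣p∣)) ⟩
  toℚ k ℚ.* 1ℚ                   ≡⟨ ℚ.*-identityʳ (toℚ k) ⟩
  toℚ k                          ∎
  where
  open ℚ.≤-Reasoning
  r = recip p

-- The common-denominator formula, nested to the right so that `∣p*q∣≤` can be applied once per
-- reciprocal factor.
recip-difference : ∀ {p q} → p ≢ 0ℚ → q ≢ 0ℚ → recip p ℚ.- recip q ≡ recip p ℚ.* (recip q ℚ.* (q ℚ.- p))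
recip-difference {p} {q} p≢0 q≢0 = begin
  r ℚ.- s                                  ≡⟨ cong₂ ℚ._-_ (ℚ.*-identityʳ r) (ℚ.*-identityʳ s) ⟨
  r ℚ.* 1ℚ ℚ.- s ℚ.* 1ℚ                    ≡⟨ cong₂ (λ u v → r ℚ.* u ℚ.- s ℚ.* v) (recip-inverseʳ q≢0) (recip-inverseʳ p≢0) ⟨
  r ℚ.* (q ℚ.* s) ℚ.- s ℚ.* (p ℚ.* r)      ≡⟨ solve 4 (λ p q r s → r :* (q :* s) :- s :* (p :* r) := r :* (s :* (q :- p))) refl p q r s ⟩
  r ℚ.* (s ℚ.* (q ℚ.- p))                  ∎
  where
  open ≡-Reasoning
  open ℚ.+-*-Solver
  r = recip p
  s = recip q

-- Null sequences

Eventually : (ℕ⁺ → Set) → Set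
Eventually P = ∃[ n₀ ] (∀ n → n₀ ≤⁺ n → P n)

Eventually-map : ∀ {P Q} → (∀ {n} → P n → Q n) → Eventually P → Eventually Q
Eventually-map f (n₀ , p) = n₀ , λ n n≥ → f (p n n≥)

Eventually-zipWith : ∀ {P Q R} → (∀ {n} → P n → Q n → R n) → Eventually P → Eventually Q → Eventually R
Eventually-zipWith f (n₁ , p) (n₂ , q) =
  n₁ ⊔⁺ n₂ , λ n n≥ → f (p n (m⊔⁺n≤o⇒m≤o n₁ n₂ n≥)) (q n (m⊔⁺n≤o⇒n≤o n₁ n₂ n≥))

-- `a ∼ b` unfolds to `Null` of the termwise difference, so the closure lemmas below speak directly
-- about closeness.
Null : (ℕ⁺ → ℚ) → Set
Null f = ∀ k → Eventually (λ n → ∣ f n ∣ ℚ.≤ 1/⁺ k)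

eventuallyZero⇒Null : ∀ {f} → Eventually (λ n → f n ≡ 0ℚ) → Null f
eventuallyZero⇒Null f≡0 k = Eventually-map
  (λ fn≡0 → subst (ℚ._≤ 1/⁺ k) (sym (cong ∣_∣ fn≡0)) (ℚ.<⇒≤ (0<1/⁺ k))) f≡0

Null-resp-≗ : ∀ {f g} → (∀ n → f n ≡ g n) → Null f → Null g
Null-resp-≗ f≗g f→0 k = Eventually-map (λ {n} → subst (λ q → ∣ q ∣ ℚ.≤ 1/⁺ k) (f≗g n)) (f→0 k)

Null-+ : ∀ {f g} → Null f → Null g → Null (λ n → f n ℚ.+ g n)
Null-+ {f} {g} f→0 g→0 k = Eventually-zipWith
  (λ {n} f≤ g≤ → ℚ.≤-trans (ℚ.∣p+q∣≤∣p∣+∣q∣ (f n) (g n))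
    (ℚ.≤-trans (ℚ.+-mono-≤ f≤ g≤) (ℚ.≤-reflexive (1/⁺-halves k))))
  (f→0 (2⁺ *⁺ k)) (g→0 (2⁺ *⁺ k))

-- Once |a n| ≤ j, precision 1/(jk) for `f` gives j · 1/(jk) = 1/k for the product.
Null-* : ∀ (a : C) {f} → Null f → Null (λ n → seq a n ℚ.* f n)
Null-* a f→0 k =
  let j , bounded = eventuallyBounded {seq a} (isCauchy a)
  in Eventually-zipWith
    (λ {n} a≤ f≤ → ℚ.≤-trans (∣p*q∣≤ {seq a n} j a≤ f≤) (ℚ.≤-reflexive (toℚ*1/⁺ j k)))
    bounded (f→0 (j *⁺ k))

-- Closeness and the ring operations

∼-refl : ∀ {a} → a ∼ a
∼-refl {a} = eventuallyZero⇒Null {λ n → seq a n ℚ.- seq a n} (1⁺ , λ n _ → ℚ.+-inverseʳ (seq a n))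

≈⇒∼ : ∀ {a b} → a ≈ b → a ∼ b
≈⇒∼ {a} {b} a≈b = Null-resp-≗ (λ n → cong (λ q → seq a n ℚ.- q) (a≈b n)) (∼-refl {a})

∼-sym : ∀ {a b} → a ∼ b → b ∼ a
∼-sym {a} {b} a∼b k = Eventually-map
  (λ {n} → subst (ℚ._≤ 1/⁺ k) (∣p-q∣≡∣q-p∣ (seq a n) (seq b n))) (a∼b k)

∼-trans : Transitive _∼_
∼-trans {a} {b} {c} a∼b b∼c = Null-resp-≗
  (λ n → solve 3 (λ p q r → (p :- q) :+ (q :- r) := p :- r) refl (seq a n) (seq b n) (seq c n))
  (Null-+ a∼b b∼c)
  where open ℚ.+-*-Solver

∼-isEquivalence : IsEquivalence _∼_
∼-isEquivalence = record
  { refl  = λ {a} → ∼-refl {a}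
  ; sym   = λ {a} {b} → ∼-sym {a} {b}
  ; trans = λ {a} {b} {c} → ∼-trans {a} {b} {c}
  }

+-congruent : ∀ {a a′ b b′} → a ∼ a′ → b ∼ b′ → a + b ∼ a′ + b′
+-congruent {a} {a′} {b} {b′} a∼a′ b∼b′ = Null-resp-≗
  (λ n → solve 4 (λ p p′ q q′ → (p :- p′) :+ (q :- q′) := (p :+ q) :- (p′ :+ q′)) refl
    (seq a n) (seq a′ n) (seq b n) (seq b′ n))
  (Null-+ a∼a′ b∼b′)
  where open ℚ.+-*-Solver

-- The difference of products splits as p(q - q′) + q′(p - p′), each summand a Cauchy sequence times
-- a null one.
*-congruent : ∀ {a a′ b b′} → a ∼ a′ → b ∼ b′ → a * b ∼ a′ * b′
*-congruent {a} {a′} {b} {b′} a∼a′ b∼b′ = Null-resp-≗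
  (λ n → solve 4 (λ p p′ q q′ → p :* (q :- q′) :+ q′ :* (p :- p′) := p :* q :- p′ :* q′) refl
    (seq a n) (seq a′ n) (seq b n) (seq b′ n))
  (Null-+ (Null-* a b∼b′) (Null-* b′ a∼a′))
  where open ℚ.+-*-Solver

infix 8 -_

-_ : Op₁ C
- a = mkC (λ n → ℚ.- seq a n) λ k →
  let n₀ , close = isCauchy a k
  in n₀ , λ m n m≥ n≥ → subst (ℚ._≤ 1/⁺ k) (eq (seq a m) (seq a n)) (close m n m≥ n≥)
  where
  eq : ∀ p q → ∣ p ℚ.- q ∣ ≡ ∣ ℚ.- p ℚ.- ℚ.- q ∣
  eq p q = trans (sym (ℚ.∣-p∣≡∣p∣ (p ℚ.- q))) (cong ∣_∣ (ℚ.neg-distrib-+ p (ℚ.- q)))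

isCommutativeRing : IsCommutativeRing _≈_ _+_ _*_ -_ 0C 1C
isCommutativeRing = record
  { isRing = record
    { +-isAbelianGroup = record
      { isGroup = record
        { isMonoid = record
          { isSemigroup = record
            { isMagma = record
              { isEquivalence = record
                { refl  = λ _ → refl
                ; sym   = λ a≈b n → sym (a≈b n)
                ; trans = λ a≈b b≈c n → trans (a≈b n) (b≈c n)
                }
              ; ∙-cong = λ a≈a′ b≈b′ n → cong₂ ℚ._+_ (a≈a′ n) (b≈b′ n)
              }
            ; assoc = λ a b c n → ℚ.+-assoc (seq a n) (seq b n) (seq c n)
            }
          ; identity = (λ a n → ℚ.+-identityˡ (seq a n)) , (λ a n → ℚ.+-identityʳ (seq a n))
          }
        ; inverse = (λ a n → ℚ.+-inverseˡ (seq a n)) , (λ a n → ℚ.+-inverseʳ (seq a n))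
        ; ⁻¹-cong = λ a≈b n → cong ℚ.-_ (a≈b n)
        }
      ; comm = λ a b n → ℚ.+-comm (seq a n) (seq b n)
      }
    ; *-cong     = λ a≈a′ b≈b′ n → cong₂ ℚ._*_ (a≈a′ n) (b≈b′ n)
    ; *-assoc    = λ a b c n → ℚ.*-assoc (seq a n) (seq b n) (seq c n)
    ; *-identity = (λ a n → ℚ.*-identityˡ (seq a n)) , (λ a n → ℚ.*-identityʳ (seq a n))
    ; distrib    = (λ a b c n → ℚ.*-distribˡ-+ (seq a n) (seq b n) (seq c n))
                 , (λ a b c n → ℚ.*-distribʳ-+ (seq a n) (seq b n) (seq c n))
    }
  ; *-comm = λ a b n → ℚ.*-comm (seq a n) (seq b n)
  }

-- The order

<-irrefl : Irreflexive _≈_ _<_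
<-irrefl {a} {b} a≈b (k , n₀ , a<b) = ℚ.<-irrefl (a≈b n₀) (ℚ.<-trans (a<b n₀ ℕ.≤-refl) (p-1/⁺k<p (seq b n₀) k))

<-trans : Transitive _<_
<-trans {a} {b} {c} (k , a<b) (l , b<c) = l , Eventually-zipWith
  (λ {n} a<b b<c → ℚ.<-trans (ℚ.<-trans a<b (p-1/⁺k<p (seq b n) k)) b<c) a<b b<c

-- The gap 1/k is divided up: 1/(4k) pays for passing from `a` to `a′`, 1/(4k) for passing from `b`
-- to `b′`, and 1/(2k) remains as the new gap.
<-resp-∼ : ∀ {a a′ b b′} → a ∼ a′ → b ∼ b′ → a < b → a′ < b′
<-resp-∼ {a} {a′} {b} {b′} a∼a′ b∼b′ (k , a<b) =
  h , Eventually-zipWith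
    (λ {n} a<b (a′-a≤ , b-b′≤) → step (seq a n) (seq a′ n) (seq b n) (seq b′ n) a<b
      (∣p-q∣≤r⇒p≤q+r (seq a′ n) (seq a n) a′-a≤) (∣p-q∣≤r⇒p≤q+r (seq b n) (seq b′ n) b-b′≤))
    a<b (Eventually-zipWith _,_ (∼-sym {a} {a′} a∼a′ (2⁺ *⁺ h)) (b∼b′ (2⁺ *⁺ h)))
  where
  open ℚ.≤-Reasoning
  open ℚ.+-*-Solver
  h = 2⁺ *⁺ k
  e = 1/⁺ (2⁺ *⁺ h)
  step : ∀ p p′ q q′ → p ℚ.< q ℚ.- 1/⁺ k → p′ ℚ.≤ p ℚ.+ e → q ℚ.≤ q′ ℚ.+ e → p′ ℚ.< q′ ℚ.- 1/⁺ h
  step p p′ q q′ p<q-1/k p′≤ q≤ = begin-strict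
    p′                                                ≤⟨ p′≤ ⟩
    p ℚ.+ e                                           <⟨ ℚ.+-monoˡ-< e p<q-1/k ⟩
    q ℚ.- 1/⁺ k ℚ.+ e                                 ≤⟨ ℚ.+-monoˡ-≤ e (ℚ.+-monoˡ-≤ (ℚ.- 1/⁺ k) q≤) ⟩
    q′ ℚ.+ e ℚ.- 1/⁺ k ℚ.+ e                          ≡⟨ cong (λ r → q′ ℚ.+ e ℚ.- r ℚ.+ e) (1/⁺-halves k) ⟨
    q′ ℚ.+ e ℚ.- (1/⁺ h ℚ.+ 1/⁺ h) ℚ.+ e              ≡⟨ cong (λ r → q′ ℚ.+ e ℚ.- (1/⁺ h ℚ.+ r) ℚ.+ e) (1/⁺-halves h) ⟨
    q′ ℚ.+ e ℚ.- (1/⁺ h ℚ.+ (e ℚ.+ e)) ℚ.+ e          ≡⟨ solve 3 (λ q e h → q :+ e :- (h :+ (e :+ e)) :+ e := q :- h) refl q′ e (1/⁺ h) ⟩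
    q′ ℚ.- 1/⁺ h                                      ∎

<-congruent : CongruentRel _∼_ _<_
<-congruent {a} {a′} {b} {b′} a∼a′ b∼b′ = mk⇔
  (<-resp-∼ {a} {a′} {b} {b′} a∼a′ b∼b′)
  (<-resp-∼ {a′} {a} {b′} {b} (∼-sym {a} {a′} a∼a′) (∼-sym {b} {b′} b∼b′))

+-mono-< : ∀ a b c → a < b → a + c < b + c
+-mono-< a b c (k , a<b) = k , Eventually-map
  (λ {n} a<b → subst (seq a n ℚ.+ seq c n ℚ.<_)
    (solve 3 (λ q r k → q :- k :+ r := q :+ r :- k) refl (seq b n) (seq c n) (1/⁺ k))
    (ℚ.+-monoˡ-< (seq c n) a<b))
  a<b
  where open ℚ.+-*-Solver

-- Gaps multiply: factors eventually above 1/k and 1/l have a product above 1/(kl).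
*-pos : ∀ a b → 0C < a → 0C < b → 0C < a * b
*-pos a b (k , 0<a) (l , 0<b) = k *⁺ l , Eventually-zipWith (λ {n} → step (seq a n) (seq b n)) 0<a 0<b
  where
  open ℚ.≤-Reasoning
  step : ∀ p q → 0ℚ ℚ.< p ℚ.- 1/⁺ k → 0ℚ ℚ.< q ℚ.- 1/⁺ l → 0ℚ ℚ.< p ℚ.* q ℚ.- 1/⁺ (k *⁺ l)
  step p q 0<p-1/k 0<q-1/l = p<q-r⇒r<q-p (1/⁺ (k *⁺ l)) (p ℚ.* q) 0ℚ (begin-strict
    1/⁺ (k *⁺ l)        ≡⟨ 1/⁺-*⁺ k l ⟩
    1/⁺ k ℚ.* 1/⁺ l     <⟨ ℚ.*-monoˡ-<-pos (1/⁺ l) {{1/⁺-pos l}} 1/k<p ⟩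
    p ℚ.* 1/⁺ l         <⟨ ℚ.*-monoʳ-<-pos p {{ℚ.positive (ℚ.<-trans (0<1/⁺ k) 1/k<p)}} 1/l<q ⟩
    p ℚ.* q             ≡⟨ ℚ.+-identityʳ (p ℚ.* q) ⟨
    p ℚ.* q ℚ.- 0ℚ      ∎)
    where
    1/k<p = subst (1/⁺ k ℚ.<_) (ℚ.+-identityʳ p) (p<q-r⇒r<q-p 0ℚ p (1/⁺ k) 0<p-1/k)
    1/l<q = subst (1/⁺ l ℚ.<_) (ℚ.+-identityʳ q) (p<q-r⇒r<q-p 0ℚ q (1/⁺ l) 0<q-1/l)

-- The sequence stays within 1/(4k) of its value at some n₀, so comparing that
-- single value with 1/(2k) decides which alternative holds.
eventuallyPos-or-≤ : ∀ c → IsCauchy c → ∀ k →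
                     (∃[ l ] Eventually (λ n → 1/⁺ l ℚ.< c n)) ⊎ Eventually (λ n → c n ℚ.≤ 1/⁺ k)
eventuallyPos-or-≤ c cauchy k = compare (cauchy (2⁺ *⁺ h))
  where
  open ℚ.≤-Reasoning
  h = 2⁺ *⁺ k
  e = 1/⁺ (2⁺ *⁺ h)
  compare : ∃[ n₀ ] (∀ m n → n₀ ≤⁺ m → n₀ ≤⁺ n → ∣ c m ℚ.- c n ∣ ℚ.≤ e) →
            (∃[ l ] Eventually (λ n → 1/⁺ l ℚ.< c n)) ⊎ Eventually (λ n → c n ℚ.≤ 1/⁺ k)
  compare (n₀ , close) with 1/⁺ h ℚ.<? c n₀
  ... | yes 1/h<c = inj₁ (2⁺ *⁺ h , n₀ , λ n n≥ → p+r<q+r⇒p<q e (c n) e (begin-strict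
    e ℚ.+ e         ≡⟨ 1/⁺-halves h ⟩
    1/⁺ h           <⟨ 1/h<c ⟩
    c n₀            ≤⟨ ∣p-q∣≤r⇒p≤q+r (c n₀) (c n) (close n₀ n ℕ.≤-refl n≥) ⟩
    c n ℚ.+ e       ∎))
  ... | no 1/h≮c = inj₂ (n₀ , λ n n≥ → begin
    c n                  ≤⟨ ∣p-q∣≤r⇒p≤q+r (c n) (c n₀) (close n n₀ n≥ ℕ.≤-refl) ⟩
    c n₀ ℚ.+ e           ≤⟨ ℚ.+-mono-≤ (ℚ.≮⇒≥ 1/h≮c) (1/⁺[2*]≤1/⁺ h) ⟩
    1/⁺ h ℚ.+ 1/⁺ h      ≡⟨ 1/⁺-halves k ⟩
    1/⁺ k                ∎)

<-or-eventually≤ : ∀ a b k → a < b ⊎ Eventually (λ n → seq b n ℚ.- seq a n ℚ.≤ 1/⁺ k)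
<-or-eventually≤ a b k = Sum.map₁ (λ (l , 1/l<b-a) → l , Eventually-map (λ {n} → p<q-r⇒r<q-p (1/⁺ l) (seq b n) (seq a n)) 1/l<b-a)
  -- The terms of `b + - a` are by definition the differences `seq b n ℚ.- seq a n`, and closure of
  -- `C` supplies the Cauchy property.
  (eventuallyPos-or-≤ (seq (b + - a)) (isCauchy (b + - a)) k)

≮⇒eventually≤ : ∀ a b → ¬ (a < b) → ∀ k → Eventually (λ n → seq b n ℚ.- seq a n ℚ.≤ 1/⁺ k)
≮⇒eventually≤ a b a≮b k = [ (λ a<b → ⊥-elim (a≮b a<b)) , id ]′ (<-or-eventually≤ a b k)

≮∧≯⇒∼ : ∀ a b → ¬ (a < b) → ¬ (b < a) → a ∼ b
≮∧≯⇒∼ a b a≮b b≮a k = Eventually-zipWith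
  (λ {n} a-b≤ b-a≤ → p≤q∧-p≤q⇒∣p∣≤q a-b≤ (subst (ℚ._≤ 1/⁺ k) (sym (-[p-q]≡q-p (seq a n) (seq b n))) b-a≤))
  (≮⇒eventually≤ b a b≮a k) (≮⇒eventually≤ a b a≮b k)

-- The dichotomy above chooses an alternative for one `k` at a time. Deciding `a < b` and `b < a` by
-- excluded middle settles the choice for all `k` at once.
weakTrichotomy : ExcludedMiddle 0ℓ → ∀ a b → a < b ⊎ b < a ⊎ a ∼ b
weakTrichotomy em a b with em {a < b} | em {b < a}
... | yes a<b | _       = inj₁ a<b
... | no _    | yes b<a = inj₂ (inj₁ b<a)
... | no a≮b  | no b≮a  = inj₂ (inj₂ (≮∧≯⇒∼ a b a≮b b≮a))

-- Weak inverses

-- Stated with the absolute value so that reciprocals of positive and negative sequences are treated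
-- together.
BoundedAwayFromZero : C → Set
BoundedAwayFromZero a = ∃[ k ] Eventually (λ n → 1/⁺ k ℚ.≤ ∣ seq a n ∣)

>0⇒boundedAway : ∀ a → 0C < a → BoundedAwayFromZero a
>0⇒boundedAway a (k , 0<a) = k , Eventually-map
  (λ {n} 0<a → ℚ.≤-trans (ℚ.<⇒≤ (subst (1/⁺ k ℚ.<_) (ℚ.+-identityʳ (seq a n)) (p<q-r⇒r<q-p 0ℚ (seq a n) (1/⁺ k) 0<a))) (p≤∣p∣ (seq a n)))
  0<a

-- The gap gives 1/k < 0 - a n, and |0 - a n| = |a n|.
<0⇒boundedAway : ∀ a → a < 0C → BoundedAwayFromZero a
<0⇒boundedAway a (k , a<0) = k , Eventually-map
  (λ {n} a<0 → subst (1/⁺ k ℚ.≤_) (trans (cong ∣_∣ (ℚ.+-identityˡ (ℚ.- seq a n))) (ℚ.∣-p∣≡∣p∣ (seq a n)))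
    (ℚ.≤-trans (ℚ.<⇒≤ (p<q-r⇒r<q-p (seq a n) 0ℚ (1/⁺ k) a<0)) (p≤∣p∣ (0ℚ ℚ.- seq a n))))
  a<0

≁0⇒boundedAway : ExcludedMiddle 0ℓ → ∀ a → ¬ (a ∼ 0C) → BoundedAwayFromZero a
≁0⇒boundedAway em a a≁0 with weakTrichotomy em a 0C
... | inj₁ a<0        = <0⇒boundedAway a a<0
... | inj₂ (inj₁ 0<a) = >0⇒boundedAway a 0<a
... | inj₂ (inj₂ a∼0) = ⊥-elim (a≁0 a∼0)

-- Each reciprocal is at most k in absolute value, so the precision 1/(k · k · l) loses one factor k
-- to each and leaves 1/l.
∣recip-difference∣≤ : ∀ {p q} k l → 1/⁺ k ℚ.≤ ∣ p ∣ → 1/⁺ k ℚ.≤ ∣ q ∣ →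
                      ∣ p ℚ.- q ∣ ℚ.≤ 1/⁺ (k *⁺ (k *⁺ l)) → ∣ recip p ℚ.- recip q ∣ ℚ.≤ 1/⁺ l
∣recip-difference∣≤ {p} {q} k l p≥ q≥ close = begin
  ∣ recip p ℚ.- recip q ∣                        ≡⟨ cong ∣_∣ (recip-difference (1/⁺k≤∣p∣⇒p≢0 k p≥) (1/⁺k≤∣p∣⇒p≢0 k q≥)) ⟩
  ∣ recip p ℚ.* (recip q ℚ.* (q ℚ.- p)) ∣        ≤⟨ ∣p*q∣≤ {recip p} k (∣recip∣≤ k p≥) (∣p*q∣≤ {recip q} k (∣recip∣≤ k q≥)
                                                      (subst (ℚ._≤ 1/⁺ (k *⁺ (k *⁺ l))) (∣p-q∣≡∣q-p∣ p q) close)) ⟩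
  toℚ k ℚ.* (toℚ k ℚ.* 1/⁺ (k *⁺ (k *⁺ l)))      ≡⟨ cong (toℚ k ℚ.*_) (toℚ*1/⁺ k (k *⁺ l)) ⟩
  toℚ k ℚ.* 1/⁺ (k *⁺ l)                         ≡⟨ toℚ*1/⁺ k l ⟩
  1/⁺ l                                          ∎
  where open ℚ.≤-Reasoning

recip-isCauchy : ∀ a → BoundedAwayFromZero a → IsCauchy (λ n → recip (seq a n))
recip-isCauchy a (k , n₁ , a≥) l =
  let n₂ , close = isCauchy a (k *⁺ (k *⁺ l))
      ≥n₁ = λ {o} → m⊔⁺n≤o⇒m≤o n₁ n₂ {o}
      ≥n₂ = λ {o} → m⊔⁺n≤o⇒n≤o n₁ n₂ {o}
  in n₁ ⊔⁺ n₂ , λ m n m≥ n≥ →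
    ∣recip-difference∣≤ k l (a≥ m (≥n₁ m≥)) (a≥ n (≥n₁ n≥)) (close m n (≥n₂ m≥) (≥n₂ n≥))

-- From the index where the bound starts, the terms are nonzero and the product is exactly 1;
-- closeness ignores the finitely many earlier terms.
boundedAway⇒weakInverse : ∀ a → BoundedAwayFromZero a → ∃[ b ] (a * b ∼ 1C)
boundedAway⇒weakInverse a away@(k , a≥) =
  mkC (λ n → recip (seq a n)) (recip-isCauchy a away) ,
  eventuallyZero⇒Null (Eventually-map
    (λ 1/k≤∣a∣ → trans (cong (ℚ._- 1ℚ) (recip-inverseʳ (1/⁺k≤∣p∣⇒p≢0 k 1/k≤∣a∣))) (ℚ.+-inverseʳ 1ℚ)) a≥)

theorem3p4 : ExcludedMiddle 0ℓ → IsOrderedFieldCongruentTo _≈_ _∼_ 0C 1C _+_ _*_ _<_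
theorem3p4 em = record
  { ∼-isEquivalence   = ∼-isEquivalence
  ; ≈⇒∼               = λ {a} {b} → ≈⇒∼ {a} {b}
  ; -_                = -_
  ; isCommutativeRing = isCommutativeRing
  ; +-congruent       = λ {a} {a′} {b} {b′} → +-congruent {a} {a′} {b} {b′}
  ; *-congruent       = λ {a} {a′} {b} {b′} → *-congruent {a} {a′} {b} {b′}
  ; <-irrefl          = λ {a} {b} → <-irrefl {a} {b}
  ; <-trans           = λ {a} {b} {c} → <-trans {a} {b} {c}
  ; <-congruent       = λ {a} {a′} {b} {b′} → <-congruent {a} {a′} {b} {b′}
  ; +-mono-<          = +-mono-<
  ; *-pos             = *-pos
  -- Excluded middle enters in this field and the next, here through trichotomy of `a` against `0C`.
  ; weakInverse       = λ a a≁0 → boundedAway⇒weakInverse a (≁0⇒boundedAway em a a≁0)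
  ; weakTrichotomy    = weakTrichotomy em
  }
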